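{- $n(3,5)=18$, $n(4,6)=37$, $27\le n(3,6)\le 28$, $74\le n(5,7)\le 75$, and $150\le n(6,8)\le 151$.
   Context: A standard box in $\mathbb{R}^d$ is a set $K=K_1\times\cdots\times K_d$ where each $K_i\subseteq\mathbb{R}$ is a closed interval. A finite family of $d$-dimensional standard boxes in $\mathbb{R}^d$ is called $k$-neighborly if the dimension of the intersection of any two distinct members is in $\{d-k,d-k+1,\ldots,d-1\}$ (in particular the intersection is nonempty). For positive integers $1\le k\le d$, $n(k,d)$ is the maximum number of members of a $k$-neighborly family of $d$-dimensional standard boxes in $\mathbb{R}^d$. -}

module Defs where

open import Data.Fin using (Fin)
open import Data.Fin.Subset using (Subset; ∣_∣; _∈_; _∉_)
open import Data.Nat as ℕ using (ℕ; _∸_)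
open import Data.Product using (_×_; ∃; ∃-syntax)
open import Data.Rational as ℚ using (ℚ)
open import Data.Sum using (_⊎_)
open import Data.Vec.Functional using (Vector)
open import Level using (0ℓ; suc)
open import Relation.Binary.PropositionalEquality using (_≡_; _≢_)
open import Relation.Nullary using (¬_)
open import Relation.Unary using (Pred; _∩_; _≐_)

-- Two-sided Dedekind cuts: q lies in `lower x` when q < x, and in
-- `upper x` when x < q.  Everything below uses only the order of ℝ,
-- so no arithmetic on cuts is developed.
record ℝ : Set₁ where
  field
    lower upper     : Pred ℚ 0ℓ
    lower-inhabited : ∃ lower
    upper-inhabited : ∃ upper
    lower-closed    : ∀ {q r} → q ℚ.< r → lower r → lower q
    upper-closed    : ∀ {q r} → q ℚ.< r → upper q → upper r
    lower-rounded   : ∀ {q} → lower q → ∃[ r ] (q ℚ.< r × lower r)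
    upper-rounded   : ∀ {r} → upper r → ∃[ q ] (q ℚ.< r × upper q)
    disjoint        : ∀ {q} → ¬ (lower q × upper q)
    located         : ∀ {q r} → q ℚ.< r → lower q ⊎ upper r

open ℝ public

infix 4 _≤_ _<_ _≈_

_≤_ : ℝ → ℝ → Set
x ≤ y = ∀ q → lower x q → lower y q

_<_ : ℝ → ℝ → Set
x < y = ∃[ q ] (upper x q × lower y q)

_≈_ : ℝ → ℝ → Set
x ≈ y = x ≤ y × y ≤ x

record ClosedInterval : Set₁ where
  field
    lo hi : ℝ
    lo≤hi : lo ≤ hi

open ClosedInterval public

Point : ℕ → Set₁
Point d = Vector ℝ d

Box : ℕ → Set₁
Box d = Vector ClosedInterval d

⟦_⟧ : ∀ {d} → Box d → Pred (Point d) 0ℓ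
⟦ K ⟧ x = ∀ i → lo (K i) ≤ x i × x i ≤ hi (K i)

-- The dimension of a box is the number of its factors that are not single
-- points.  It is a relation, not a function, because `lo < hi` is
-- undecidable; T is the set of nondegenerate coordinates.
BoxDim : ∀ {d} → Box d → ℕ → Set
BoxDim {d} K m =
  ∃[ T ] (∣ T ∣ ≡ m
        × (∀ i → i ∈ T → lo (K i) < hi (K i))
        × (∀ i → i ∉ T → lo (K i) ≈ hi (K i)))

-- Boxes are nonempty, so the empty set has no dimension.
Dim : ∀ {d} → Pred (Point d) 0ℓ → ℕ → Set₁
Dim S m = ∃[ B ] (S ≐ ⟦ B ⟧ × BoxDim B m)

-- Families are indexed.  Since two equal full-dimensional boxes meet in
-- dimension d, the last condition already forces boxes with different
-- indices to be different, so the index type counts the members.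
record Neighborly (k d : ℕ) {m : ℕ} (F : Fin m → Box d) : Set₁ where
  field
    full-dimensional : ∀ i → BoxDim (F i) d
    intersections    : ∀ i j → i ≢ j →
      ∃[ e ] (Dim (⟦ F i ⟧ ∩ ⟦ F j ⟧) e × d ∸ k ℕ.≤ e × e ℕ.≤ d ∸ 1)

NeighborlyFamily : (k d m : ℕ) → Set₁
NeighborlyFamily k d m = ∃[ F ] Neighborly k d {m} F

-- n(k,d) = m.  Such an m is unique, so a bound a ≤ n(k,d) ≤ b reads
-- ∃[ m ] (n⟨ k , d ⟩≔ m × a ≤ m × m ≤ b).
n⟨_,_⟩≔_ : (k d m : ℕ) → Set₁
n⟨ k , d ⟩≔ m = NeighborlyFamily k d m × (∀ m′ → NeighborlyFamily k d m′ → m′ ℕ.≤ m)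

{-# OPTIONS --safe #-}
module Submission where

-- In a fixed coordinate all degenerate intersections of two boxes of the family
-- happen at one common point; recording for every box whether its factor ends
-- there, starts there, or neither turns a k-neighborly family into words over
-- {0, 1, ∗} that pairwise clash in at least 1 and at most k places.  These words
-- are pairwise disjoint subcubes of the d-cube.  Subcubes through two antipodal
-- vertices have together at least d - k jokers, so a suitable weighting of the
-- vertices bounds the number of subcubes in terms of the number of those that
-- are single vertices.  The latter form a set of diameter at most k, whose size
-- is bounded through Harper's vertex isoperimetric inequality.

open import Data.Bool using (Bool; true; false; not; if_then_else_; _∧_; _∨_; _xor_)
import Data.Bool.Properties as Bool
open import Data.Empty using (⊥)
open import Data.Fin using (Fin; zero; suc)
open import Data.Fin.Properties using (any?; all?)
import Data.Fin.Properties as Fin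
open import Data.Fin.Subset using (Subset; ∣_∣; _∈_; _∉_; ∁)
import Data.Fin.Subset.Properties as Subset
open import Data.List as List using (List; []; _∷_; _++_; concatMap; upTo; scanl; length; cartesianProductWith)
open import Data.List.Membership.Propositional.Properties using (∈-lookup)
import Data.List.Relation.Unary.All as All
open import Data.List.Relation.Unary.AllPairs using (AllPairs; _∷_; allPairs?)
open import Data.Maybe using (Maybe; just; nothing)
import Data.Maybe.Properties as Maybe
open import Data.Nat
open import Data.Nat.Properties
open import Algebra.Properties.Semiring.Sum +-*-semiring using (sum; sum-syntax; ∑-distrib-+; sum-replicate-zero; sum-cong-≗)
open import Data.Nat.Tactic.RingSolver using (solve-∀)
open import Data.Product using (_×_; _,_; ∃; ∃-syntax; proj₁; proj₂)
open import Data.Rational as ℚ using (ℚ; 0ℚ; 1ℚ)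
import Data.Rational.Properties as ℚ
open import Data.Sum using (_⊎_; inj₁; inj₂; [_,_]′)
open import Data.Vec as Vec using (Vec; []; _∷_; map; zipWith; lookup; tabulate; head)
open import Data.Vec.Functional using (updateAt)
open import Data.Vec.Functional.Properties using (updateAt-updates; updateAt-minimal)
import Data.Vec.Properties as Vec
open import Function using (_∘_; const; _⇔_; mk⇔; Equivalence)
open import Level using (Level)
open import Relation.Binary using (tri<; tri≈; tri>; Symmetric)
open import Relation.Binary.PropositionalEquality using (_≡_; _≢_; refl; sym; trans; cong; cong₂; subst; subst₂)
open import Relation.Nullary using (¬_; Dec; yes; no; does; contradiction)
open import Relation.Nullary.Decidable using (True; toWitness; from-yes; dec-true; map′; ¬?; _×-dec_; _→-dec_)
open import Relation.Unary using (_∩_; _≐_)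

open import Defs using (n⟨_,_⟩≔_)
open import Defs using (ℝ; lower; upper; lower-closed; lower-rounded; upper-closed; disjoint; located)
open import Defs using (ClosedInterval; lo; hi; lo≤hi; Box; ⟦_⟧; BoxDim; Neighborly; NeighborlyFamily)
open import Defs using () renaming (_≤_ to _≤ʳ_; _<_ to _<ʳ_; _≈_ to _≈ʳ_)

private
  variable
    a ℓ : Level
    A : Set a
    d k m n : ℕ
    x y z : ℝ
    I J : ClosedInterval
    p q : ℚ

-- Words and subcubes

Letter : Set
Letter = Maybe Bool

Word Vertex : ℕ → Set
Word = Vec Letter
Vertex = Vec Bool

clash : Letter → Letter → Bool
clash (just a) (just b) = a xor b
clash _        _        = false

clash-comm : ∀ u v → clash u v ≡ clash v u
clash-comm (just u) (just v) = Bool.xor-comm u v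
clash-comm (just u) nothing  = refl
clash-comm nothing  (just v) = refl
clash-comm nothing  nothing  = refl

clashes : Word d → Word d → Subset d
clashes = zipWith clash

dist : Word d → Word d → ℕ
dist u v = ∣ clashes u v ∣

IsCode : (k : ℕ) → (Fin m → Word d) → Set
IsCode k w = ∀ i j → i ≢ j → 1 ≤ dist (w i) (w j) × dist (w i) (w j) ≤ k

Code : (k d m : ℕ) → Set
Code k d m = ∃[ w ] IsCode {m} {d} k w

-- A word stands for a subcube: its jokers `nothing` are the free coordinates.
covers : Word d → Vertex d → Bool
covers []            []      = true
covers (nothing ∷ w) (b ∷ x) = covers w x
covers (just a ∷ w)  (b ∷ x) = not (a xor b) ∧ covers w x

jokers : Word d → ℕ
jokers []            = 0
jokers (nothing ∷ w) = suc (jokers w)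
jokers (just _ ∷ w)  = jokers w

antipode : Vertex d → Vertex d
antipode = map not

⌈_⌉ : Vertex d → Word d
⌈_⌉ = map just

dist-self : (w : Word d) → dist w w ≡ 0
dist-self []               = refl
dist-self (nothing ∷ w)    = dist-self w
dist-self (just false ∷ w) = dist-self w
dist-self (just true ∷ w)  = dist-self w

-- A clash would ask for two different bits of `x` in one coordinate.
covers⇒dist≡0 : ∀ (u v : Word d) x → covers u x ≡ true → covers v x ≡ true → dist u v ≡ 0
covers⇒dist≡0 []               []               []          _ _ = refl
covers⇒dist≡0 (nothing ∷ u)    (nothing ∷ v)    (_ ∷ x)     p q = covers⇒dist≡0 u v x p q
covers⇒dist≡0 (nothing ∷ u)    (just true ∷ v)  (true ∷ x)  p q = covers⇒dist≡0 u v x p q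
covers⇒dist≡0 (nothing ∷ u)    (just false ∷ v) (false ∷ x) p q = covers⇒dist≡0 u v x p q
covers⇒dist≡0 (just true ∷ u)  (nothing ∷ v)    (true ∷ x)  p q = covers⇒dist≡0 u v x p q
covers⇒dist≡0 (just false ∷ u) (nothing ∷ v)    (false ∷ x) p q = covers⇒dist≡0 u v x p q
covers⇒dist≡0 (just true ∷ u)  (just true ∷ v)  (true ∷ x)  p q = covers⇒dist≡0 u v x p q
covers⇒dist≡0 (just false ∷ u) (just false ∷ v) (false ∷ x) p q = covers⇒dist≡0 u v x p q

-- If neither word has a joker in a coordinate, their letters there are the bits of `x` and of its
-- antipode, and these clash. So every coordinate counts at least once on the right.
covers-antipodal : ∀ (u v : Word d) x → covers u x ≡ true → covers v (antipode x) ≡ true →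
                   d ≤ dist u v + (jokers u + jokers v)
covers-antipodal []               []               []          _ _ = z≤n
covers-antipodal (nothing ∷ u)    (nothing ∷ v)    (_ ∷ x)     p q =
  ≤-trans (s≤s (m≤n⇒m≤1+n (covers-antipodal u v x p q)))
    (≤-reflexive (shift (dist u v) (jokers u) (jokers v)))
  where
  shift : ∀ a b c → 2 + (a + (b + c)) ≡ a + (suc b + suc c)
  shift = solve-∀
covers-antipodal (nothing ∷ u)    (just true ∷ v)  (false ∷ x) p q =
  ≤-trans (s≤s (covers-antipodal u v x p q)) (≤-reflexive (sym (+-suc (dist u v) _)))
covers-antipodal (nothing ∷ u)    (just false ∷ v) (true ∷ x)  p q =
  ≤-trans (s≤s (covers-antipodal u v x p q)) (≤-reflexive (sym (+-suc (dist u v) _)))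
covers-antipodal (just a ∷ u)     (nothing ∷ v)    (b ∷ x)     p q with a xor b
... | false = ≤-trans (s≤s (covers-antipodal u v x p q))
  (≤-reflexive (shift (dist u v) (jokers u) (jokers v)))
  where
  shift : ∀ a b c → suc (a + (b + c)) ≡ a + (b + suc c)
  shift = solve-∀
covers-antipodal (just true ∷ u)  (just false ∷ v) (true ∷ x)  p q = s≤s (covers-antipodal u v x p q)
covers-antipodal (just false ∷ u) (just true ∷ v)  (false ∷ x) p q = s≤s (covers-antipodal u v x p q)

covers-jokerless : ∀ (w : Word d) x → covers w x ≡ true → jokers w ≡ 0 → w ≡ ⌈ x ⌉
covers-jokerless []               []          _ _ = refl
covers-jokerless (just true ∷ w)  (true ∷ x)  p q = cong (just true ∷_) (covers-jokerless w x p q)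
covers-jokerless (just false ∷ w) (false ∷ x) p q = cong (just false ∷_) (covers-jokerless w x p q)

-- Sums over the cube

∑cube : (Vertex d → ℕ) → ℕ
∑cube {zero}  f = f []
∑cube {suc d} f = ∑cube (f ∘ (false ∷_)) + ∑cube (f ∘ (true ∷_))

∑cube-mono : {f g : Vertex d → ℕ} → (∀ x → f x ≤ g x) → ∑cube f ≤ ∑cube g
∑cube-mono {zero}  f≤g = f≤g []
∑cube-mono {suc d} f≤g = +-mono-≤ (∑cube-mono (f≤g ∘ (false ∷_))) (∑cube-mono (f≤g ∘ (true ∷_)))

∑cube-+ : (f g : Vertex d → ℕ) → ∑cube (λ x → f x + g x) ≡ ∑cube f + ∑cube g
∑cube-+ {zero}  f g = refl
∑cube-+ {suc d} f g = trans
  (cong₂ _+_ (∑cube-+ (f ∘ (false ∷_)) (g ∘ (false ∷_))) (∑cube-+ (f ∘ (true ∷_)) (g ∘ (true ∷_))))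
  (interchange (∑cube (f ∘ (false ∷_))) _ _ _)
  where
  interchange : ∀ a b c e → (a + b) + (c + e) ≡ (a + c) + (b + e)
  interchange = solve-∀

∑cube-const : ∀ d c → ∑cube {d} (λ _ → c) ≡ 2 ^ d * c
∑cube-const zero    c = sym (+-identityʳ c)
∑cube-const (suc d) c = trans (cong₂ _+_ (∑cube-const d c) (∑cube-const d c)) (double (2 ^ d) c)
  where
  double : ∀ a b → a * b + a * b ≡ (2 * a) * b
  double = solve-∀

∑cube-* : ∀ c (f : Vertex d → ℕ) → ∑cube (λ x → c * f x) ≡ c * ∑cube f
∑cube-* {zero}  c f = refl
∑cube-* {suc d} c f = trans
  (cong₂ _+_ (∑cube-* c (f ∘ (false ∷_))) (∑cube-* c (f ∘ (true ∷_))))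
  (sym (*-distribˡ-+ c _ _))

∑cube-antipode : (f : Vertex d → ℕ) → ∑cube (f ∘ antipode) ≡ ∑cube f
∑cube-antipode {zero}  f = refl
∑cube-antipode {suc d} f = trans
  (cong₂ _+_ (∑cube-antipode (f ∘ (true ∷_))) (∑cube-antipode (f ∘ (false ∷_))))
  (+-comm (∑cube (f ∘ (true ∷_))) _)

∑cube-∑ : (f : Fin m → Vertex d → ℕ) → ∑cube (λ x → ∑[ i < m ] f i x) ≡ ∑[ i < m ] ∑cube (f i)
∑cube-∑ {d = zero}  f = refl
∑cube-∑ {d = suc d} f = trans
  (cong₂ _+_ (∑cube-∑ (λ i → f i ∘ (false ∷_))) (∑cube-∑ (λ i → f i ∘ (true ∷_))))
  (sym (∑-distrib-+ (λ i → ∑cube (f i ∘ (false ∷_))) (λ i → ∑cube (f i ∘ (true ∷_)))))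

∑cube-zero : ∀ d → ∑cube {d} (λ _ → 0) ≡ 0
∑cube-zero d = trans (∑cube-const d 0) (*-zeroʳ (2 ^ d))

∑cube-covers : ∀ (w : Word d) c → ∑cube (λ x → if covers w x then c else 0) ≡ 2 ^ jokers w * c
∑cube-covers []               c = sym (+-identityʳ c)
∑cube-covers (nothing ∷ w)    c =
  trans (cong₂ _+_ (∑cube-covers w c) (∑cube-covers w c)) (double (2 ^ jokers w) c)
  where
  double : ∀ a b → a * b + a * b ≡ (2 * a) * b
  double = solve-∀
∑cube-covers {suc d} (just false ∷ w) c =
  trans (cong₂ _+_ (∑cube-covers w c) (∑cube-zero d)) (+-identityʳ _)
∑cube-covers {suc d} (just true ∷ w)  c = cong₂ _+_ (∑cube-zero d) (∑cube-covers w c)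

-- The vertex isoperimetric inequality

card : (Vertex d → Bool) → ℕ
card A = ∑cube (λ x → if A x then 1 else 0)

indicator≤1 : ∀ b → (if b then 1 else 0) ≤ 1
indicator≤1 false = z≤n
indicator≤1 true  = ≤-refl

card≤2^d : (A : Vertex d → Bool) → card A ≤ 2 ^ d
card≤2^d {d} A = ≤-trans (∑cube-mono (indicator≤1 ∘ A))
  (≤-reflexive (trans (∑cube-const d 1) (*-identityʳ _)))

-- The closed neighbourhood: all vertices within Hamming distance 1 of the set.
thicken : (Vertex d → Bool) → Vertex d → Bool
thicken A []      = A []
thicken A (b ∷ x) = thicken (A ∘ (b ∷_)) x ∨ A (not b ∷ x)

-- The default 0 makes a lower bound read off the list trivial past its end.
nth : List ℕ → ℕ → ℕ
nth []       _       = 0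
nth (x ∷ _)  zero    = x
nth (_ ∷ xs) (suc n) = nth xs n

Isoperimetric : ℕ → List ℕ → Set
Isoperimetric d t = ∀ (A : Vertex d → Bool) → nth t (card A) ≤ card (thicken A)

-- The arithmetic content of the induction on the dimension: `a` and `b` are the sizes of the two
-- slices of a set, and `n` is the number of vertices of one half of the cube.
Step : ℕ → List ℕ → List ℕ → Set
Step n t t′ = ∀ {a} → a < suc n → ∀ {b} → b < suc n →
  nth t′ (a + b) ≤ (nth t a ⊔ b) + (nth t b ⊔ a)

step? : ∀ n t t′ → Dec (Step n t t′)
step? n t t′ = allUpTo? (λ a → allUpTo? (λ b →
  nth t′ (a + b) ≤? (nth t a ⊔ b) + (nth t b ⊔ a)) (suc n)) (suc n)

-- In each half of the cube the thickening contains both the thickening of the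
-- slice there and a copy of the opposite slice.
isoperimetric-suc : ∀ {t t′} → Step (2 ^ d) t t′ → Isoperimetric d t → Isoperimetric (suc d) t′
isoperimetric-suc {t = t} {t′} step iso A = begin
  nth t′ (card A₀ + card A₁)
    ≤⟨ step (s≤s (card≤2^d A₀)) (s≤s (card≤2^d A₁)) ⟩
  (nth t (card A₀) ⊔ card A₁) + (nth t (card A₁) ⊔ card A₀)
    ≤⟨ +-mono-≤ (half A₀ A₁) (half A₁ A₀) ⟩
  card (thicken A) ∎
  where
  open ≤-Reasoning
  A₀ = A ∘ (false ∷_)
  A₁ = A ∘ (true ∷_)
  left : ∀ a b → (if a then 1 else 0) ≤ (if a ∨ b then 1 else 0)
  left false b = z≤n
  left true  b = ≤-refl
  right : ∀ a b → (if b then 1 else 0) ≤ (if a ∨ b then 1 else 0)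
  right a     false = z≤n
  right false true  = ≤-refl
  right true  true  = ≤-refl
  half : ∀ B C → nth t (card B) ⊔ card C ≤ card (λ x → thicken B x ∨ C x)
  half B C = ⊔-lub
    (≤-trans (iso B) (∑cube-mono (λ x → left (thicken B x) (C x))))
    (∑cube-mono (λ x → right (thicken B x) (C x)))

-- Adding the vertices of weight r of the n-cube in lexicographic order to the
-- ball of radius r - 1, this lists the numbers of new neighbours of weight r + 1.
increments : (n r : ℕ) → List ℕ
increments n       zero    = n ∷ []
increments zero    (suc r) = []
increments (suc n) (suc r) = increments n r ++ increments n (suc r)

-- Entry m is the size of the closed neighbourhood of the initial segment of
-- length m of the simplicial order.
harper : ℕ → List ℕ
harper n = scanl _+_ 0 (suc n ∷ concatMap (λ r → increments n (suc r)) (upTo n))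

-- In these dimensions the induction step is a finite list of inequalities between tabulated
-- numbers, decided by evaluation.
harper-steps : ∀ {n} → n < 8 → Step (2 ^ n) (harper n) (harper (suc n))
harper-steps = from-yes (allUpTo? (λ n → step? (2 ^ n) (harper n) (harper (suc n))) 8)

harper-isoperimetric : ∀ d → d ≤ 8 → Isoperimetric d (harper d)
harper-isoperimetric zero    _   A with A []
... | false = z≤n
... | true  = ≤-refl
harper-isoperimetric (suc d) d<8 =
  isoperimetric-suc {d} {harper d} {harper (suc d)} (harper-steps d<8) (harper-isoperimetric d (<⇒≤ d<8))

-- Families of vertices of bounded diameter

_≤diam_ : (Vertex d → Bool) → ℕ → Set
Z ≤diam k = ∀ x y → Z x ≡ true → Z y ≡ true → dist ⌈ x ⌉ ⌈ y ⌉ ≤ k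

dist-triangle : ∀ (x y z : Vertex d) → dist ⌈ x ⌉ ⌈ z ⌉ ≤ dist ⌈ x ⌉ ⌈ y ⌉ + dist ⌈ y ⌉ ⌈ z ⌉
dist-triangle []          []          []          = z≤n
dist-triangle (false ∷ x) (false ∷ y) (false ∷ z) = dist-triangle x y z
dist-triangle (false ∷ x) (false ∷ y) (true ∷ z)  =
  ≤-trans (s≤s (dist-triangle x y z)) (≤-reflexive (sym (+-suc _ _)))
dist-triangle (false ∷ x) (true ∷ y)  (false ∷ z) =
  m≤n⇒m≤1+n (≤-trans (dist-triangle x y z) (+-monoʳ-≤ _ (n≤1+n _)))
dist-triangle (false ∷ x) (true ∷ y)  (true ∷ z)  = s≤s (dist-triangle x y z)
dist-triangle (true ∷ x)  (false ∷ y) (false ∷ z) = s≤s (dist-triangle x y z)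
dist-triangle (true ∷ x)  (false ∷ y) (true ∷ z)  =
  m≤n⇒m≤1+n (≤-trans (dist-triangle x y z) (+-monoʳ-≤ _ (n≤1+n _)))
dist-triangle (true ∷ x)  (true ∷ y)  (false ∷ z) =
  ≤-trans (s≤s (dist-triangle x y z)) (≤-reflexive (sym (+-suc _ _)))
dist-triangle (true ∷ x)  (true ∷ y)  (true ∷ z)  = dist-triangle x y z

-- Each bit of `y` differs from that of `x` or from that of `antipode x`.
dist-antipode : ∀ (x y : Vertex d) → d ≤ dist ⌈ x ⌉ ⌈ y ⌉ + dist ⌈ antipode x ⌉ ⌈ y ⌉
dist-antipode []          []          = z≤n
dist-antipode (false ∷ x) (true ∷ y)  = s≤s (dist-antipode x y)
dist-antipode (true ∷ x)  (false ∷ y) = s≤s (dist-antipode x y)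
dist-antipode (false ∷ x) (false ∷ y) = ≤-trans (s≤s (dist-antipode x y)) (≤-reflexive (sym (+-suc _ _)))
dist-antipode (true ∷ x)  (true ∷ y)  = ≤-trans (s≤s (dist-antipode x y)) (≤-reflexive (sym (+-suc _ _)))

thicken-near : ∀ (A : Vertex d → Bool) x → thicken A x ≡ true → ∃[ y ] (A y ≡ true × dist ⌈ x ⌉ ⌈ y ⌉ ≤ 1)
thicken-near A []          p = [] , p , z≤n
thicken-near A (b ∷ x)     p with thicken (A ∘ (b ∷_)) x in eq
thicken-near A (false ∷ x) p | true  = let y , Ay , xy = thicken-near (A ∘ (false ∷_)) x eq in false ∷ y , Ay , xy
thicken-near A (true ∷ x)  p | true  = let y , Ay , xy = thicken-near (A ∘ (true ∷_)) x eq in true ∷ y , Ay , xy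
thicken-near A (false ∷ x) p | false = true ∷ x , p , s≤s (≤-reflexive (dist-self ⌈ x ⌉))
thicken-near A (true ∷ x)  p | false = false ∷ x , p , s≤s (≤-reflexive (dist-self ⌈ x ⌉))

-- The antipodal map preserves cardinality, and the image of `B` under it is disjoint from `A`.
card-antipodal : (A B : Vertex d → Bool) → (∀ x → A x ≡ true → B (antipode x) ≡ true → ⊥) →
                 card A + card B ≤ 2 ^ d
card-antipodal {d} A B apart = begin
  card A + card B
    ≡⟨ cong (card A +_) (∑cube-antipode (λ x → if B x then 1 else 0)) ⟨
  card A + card (B ∘ antipode)
    ≡⟨ ∑cube-+ (λ x → if A x then 1 else 0) (λ x → if B (antipode x) then 1 else 0) ⟨
  ∑cube (λ x → (if A x then 1 else 0) + (if B (antipode x) then 1 else 0))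
    ≤⟨ ∑cube-mono (λ x → at-most-one (A x) (B (antipode x)) (apart x)) ⟩
  ∑cube {d} (λ _ → 1)
    ≡⟨ trans (∑cube-const d 1) (*-identityʳ _) ⟩
  2 ^ d ∎
  where
  open ≤-Reasoning
  at-most-one : ∀ a b → (a ≡ true → b ≡ true → ⊥) → (if a then 1 else 0) + (if b then 1 else 0) ≤ 1
  at-most-one false b     _ = indicator≤1 b
  at-most-one true  false _ = ≤-refl
  at-most-one true  true  h = contradiction refl (h refl)

-- The antipodes of a set of diameter at most d - 2 avoid its thickening, and
-- those of a set of diameter at most d - 3 also avoid its second thickening.
diam-thicken : ∀ {Z : Vertex d → Bool} → 2 + k ≤ d → Z ≤diam k → card (thicken Z) + card Z ≤ 2 ^ d
diam-thicken {d} {k} {Z} 2+k≤d diam = card-antipodal (thicken Z) Z apart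
  where
  apart : ∀ x → thicken Z x ≡ true → Z (antipode x) ≡ true → ⊥
  apart x p q with thicken-near Z x p
  ... | y , Zy , xy = 1+n≰n (≤-trans 2+k≤d (≤-trans (dist-antipode x y) (+-mono-≤ xy (diam _ _ q Zy))))

diam-thicken² : ∀ {Z : Vertex d → Bool} → 3 + k ≤ d → Z ≤diam k →
                card (thicken (thicken Z)) + card Z ≤ 2 ^ d
diam-thicken² {d} {k} {Z} 3+k≤d diam = card-antipodal (thicken (thicken Z)) Z apart
  where
  apart : ∀ x → thicken (thicken Z) x ≡ true → Z (antipode x) ≡ true → ⊥
  apart x p q with thicken-near (thicken Z) x p
  ... | y , By , xy with thicken-near Z y By
  ... | z , Zz , yz = 1+n≰n (≤-trans 3+k≤d (≤-trans (dist-antipode x z)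
    (+-mono-≤ (≤-trans (dist-triangle x y z) (+-mono-≤ xy yz)) (diam _ _ q Zz))))

-- A condition on numbers only, hence decidable: `m` ranges over the cardinalities that Harper's
-- bound and `diam-thicken` leave possible.
Bound : (d M : ℕ) → Set
Bound d M = ∀ {m} → m < suc (2 ^ d) → nth (harper d) m + m ≤ 2 ^ d → m ≤ M

bound? : ∀ d M → Dec (Bound d M)
bound? d M = allUpTo? (λ m → (nth (harper d) m + m ≤? 2 ^ d) →-dec (m ≤? M)) (suc (2 ^ d))

diam⇒card≤ : ∀ {M} {Z : Vertex d → Bool} → d ≤ 8 → Bound d M → 2 + k ≤ d → Z ≤diam k → card Z ≤ M
diam⇒card≤ {d} {Z = Z} d≤8 bound 2+k≤d diam = bound (s≤s (card≤2^d Z))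
  (≤-trans (+-monoˡ-≤ _ (harper-isoperimetric d d≤8 Z)) (diam-thicken 2+k≤d diam))

-- `n` stands for the size of the first thickening, of which only a lower bound is known; Harper's
-- bound is applied to it a second time.
Bound² : (d M : ℕ) → Set
Bound² d M = ∀ {m} → m < suc (2 ^ d) → ∀ {n} → n < suc (2 ^ d) →
  nth (harper d) m ≤ n → nth (harper d) n + m ≤ 2 ^ d → m ≤ M

bound²? : ∀ d M → Dec (Bound² d M)
bound²? d M = allUpTo? (λ m → allUpTo? (λ n →
  (nth (harper d) m ≤? n) →-dec (nth (harper d) n + m ≤? 2 ^ d) →-dec (m ≤? M)) (suc (2 ^ d))) (suc (2 ^ d))

diam⇒card≤² : ∀ {M} {Z : Vertex d → Bool} → d ≤ 8 → Bound² d M → 3 + k ≤ d → Z ≤diam k → card Z ≤ M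
diam⇒card≤² {d} {Z = Z} d≤8 bound 3+k≤d diam = bound
  (s≤s (card≤2^d Z)) (s≤s (card≤2^d (thicken Z))) (harper-isoperimetric d d≤8 Z)
  (≤-trans (+-monoˡ-≤ _ (harper-isoperimetric d d≤8 (thicken Z))) (diam-thicken² 3+k≤d diam))

-- The constants here and below are those of Kleitman's diameter theorem: for even `k` the size of a
-- ball of radius `k / 2`, for odd `k` twice the size of a ball of radius `(k - 1) / 2` in one
-- dimension less.
bound₅ : Bound 5 10
bound₅ = from-yes (bound? 5 10)

bound₆ : Bound 6 22
bound₆ = from-yes (bound? 6 22)

bound₇ : Bound 7 44
bound₇ = from-yes (bound? 7 44)

bound₈ : Bound 8 93
bound₈ = from-yes (bound? 8 93)

bound²₆ : Bound² 6 12
bound²₆ = from-yes (bound²? 6 12)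

-- The counting bound

_≟ʷ_ : (u v : Word d) → Dec (u ≡ v)
_≟ʷ_ = Vec.≡-dec (Maybe.≡-dec Bool._≟_)

sum-mono : {f g : Fin m → ℕ} → (∀ i → f i ≤ g i) → sum f ≤ sum g
sum-mono {zero}  f≤g = z≤n
sum-mono {suc m} f≤g = +-mono-≤ (f≤g zero) (sum-mono (f≤g ∘ suc))

sum-const : ∀ m c → ∑[ i < m ] c ≡ m * c
sum-const zero    c = refl
sum-const (suc m) c = cong (c +_) (sum-const m c)

sum-zero : (f : Fin m → ℕ) → (∀ i → f i ≡ 0) → sum f ≡ 0
sum-zero {m} f f≡0 = trans (sum-cong-≗ f≡0) (sum-replicate-zero m)

sum-single : (f : Fin m → ℕ) (i : Fin m) → (∀ j → i ≢ j → f j ≡ 0) → sum f ≡ f i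
sum-single f zero    f≡0 =
  trans (cong (f zero +_) (sum-zero (f ∘ suc) (λ j → f≡0 (suc j) λ ()))) (+-identityʳ _)
sum-single f (suc i) f≡0 = cong₂ _+_ (f≡0 zero λ ())
  (sum-single (f ∘ suc) i (λ j i≢j → f≡0 (suc j) (i≢j ∘ Fin.suc-injective)))

-- Every vertex of a subcube with j free coordinates receives the weight
-- `weight j`.  The inequality pair≤ is about subcubes through two antipodal
-- vertices, and single≤ is the case in which one of the two is uncovered.  The
-- truncated difference 1 ∸ j is 1 when j = 0 and 0 otherwise.
record Weighting (t : ℕ) : Set where
  field
    weight       : ℕ → ℕ
    total        : ℕ
    base penalty : ℕ
    total≤       : ∀ j → total ≤ 2 ^ j * weight j
    single≤      : ∀ j → weight j ≤ base + penalty * (1 ∸ j)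
    pair≤        : ∀ i j → t ≤ i + j → weight i + weight j ≤ base + penalty * ((1 ∸ i) + (1 ∸ j))

module _ {w : Fin m → Word d} (isCode : IsCode k w) where

  jokerless : Vertex d → Bool
  jokerless x = does (any? (λ i → w i ≟ʷ ⌈ x ⌉))

  code-dist≤ : ∀ i j → dist (w i) (w j) ≤ k
  code-dist≤ i j with i Fin.≟ j
  ... | yes refl = ≤-trans (≤-reflexive (dist-self (w i))) z≤n
  ... | no i≢j   = proj₂ (isCode i j i≢j)

  jokerless-diam : jokerless ≤diam k
  jokerless-diam x y p q with any? (λ i → w i ≟ʷ ⌈ x ⌉) | any? (λ i → w i ≟ʷ ⌈ y ⌉)
  jokerless-diam x y p  q  | yes (i , wi≡x) | yes (j , wj≡y) =
    subst₂ (λ u v → dist u v ≤ k) wi≡x wj≡y (code-dist≤ i j)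
  jokerless-diam x y () q  | no _  | _
  jokerless-diam x y p  () | yes _ | no _

  -- Only a word without jokers matters, and such a word is the vertex itself.
  covers⇒jokerless : ∀ i x → covers (w i) x ≡ true → 1 ∸ jokers (w i) ≤ (if jokerless x then 1 else 0)
  covers⇒jokerless i x p with jokers (w i) in eq
  ... | suc j = ≤-trans (≤-reflexive (0∸n≡0 j)) z≤n
  ... | zero  = ≤-reflexive (sym (cong (if_then 1 else 0)
    (dec-true (any? (λ i → w i ≟ʷ ⌈ x ⌉)) (i , covers-jokerless (w i) x p eq))))

  covered-once : ∀ {i j} x → covers (w i) x ≡ true → i ≢ j → covers (w j) x ≡ false
  covered-once {i} {j} x p i≢j with covers (w j) x in q
  ... | false = refl
  ... | true  = contradiction (proj₁ (isCode i j i≢j))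
    (λ 1≤ → 1+n≰n (≤-trans 1≤ (≤-reflexive (covers⇒dist≡0 (w i) (w j) x p q))))

  module _ (𝓦 : Weighting (d ∸ k)) where
    open Weighting 𝓦

    share : Vertex d → Fin m → ℕ
    share x i = if covers (w i) x then weight (jokers (w i)) else 0

    load : Vertex d → ℕ
    load x = sum (share x)

    -- The subcubes are disjoint, so at most one share at `x` is counted.
    load-cases : ∀ x → (∃[ i ] (covers (w i) x ≡ true × load x ≡ weight (jokers (w i)))) ⊎ load x ≡ 0
    load-cases x with any? (λ i → covers (w i) x Bool.≟ true)
    ... | yes (i , p) = inj₁ (i , p , trans
      (sum-single (share x) i (λ j i≢j → cong (if_then weight (jokers (w j)) else 0) (covered-once x p i≢j)))
      (cong (if_then weight (jokers (w i)) else 0) p))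
    ... | no ¬p = inj₂ (sum-zero (share x)
      (λ i → cong (if_then weight (jokers (w i)) else 0) (Bool.¬-not (λ p → ¬p (i , p)))))

    heavy : Vertex d → ℕ
    heavy x = if jokerless x then 1 else 0

    load-antipodal : ∀ x → load x + load (antipode x) ≤ base + penalty * (heavy x + heavy (antipode x))
    load-antipodal x with load-cases x | load-cases (antipode x)
    ... | inj₂ p | inj₂ q rewrite p | q = z≤n
    ... | inj₁ (i , c , p) | inj₂ q rewrite p | q = begin
      weight (jokers (w i)) + 0
        ≡⟨ +-identityʳ _ ⟩
      weight (jokers (w i))
        ≤⟨ single≤ _ ⟩
      base + penalty * (1 ∸ jokers (w i))
        ≤⟨ +-monoʳ-≤ base (*-monoʳ-≤ penalty (m≤n⇒m≤n+o _ (covers⇒jokerless i x c))) ⟩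
      base + penalty * (heavy x + heavy (antipode x)) ∎
      where open ≤-Reasoning
    ... | inj₂ p | inj₁ (i , c , q) rewrite p | q = begin
      weight (jokers (w i))
        ≤⟨ single≤ _ ⟩
      base + penalty * (1 ∸ jokers (w i))
        ≤⟨ +-monoʳ-≤ base (*-monoʳ-≤ penalty (m≤n⇒m≤o+n (heavy x) (covers⇒jokerless i (antipode x) c))) ⟩
      base + penalty * (heavy x + heavy (antipode x)) ∎
      where open ≤-Reasoning
    ... | inj₁ (i , c , p) | inj₁ (j , c′ , q) rewrite p | q = begin
      weight (jokers (w i)) + weight (jokers (w j))
        -- At most `k` clashes leave at least `d - k` jokers. The two words may coincide, which
        -- `code-dist≤` allows.
        ≤⟨ pair≤ _ _ (m≤n+o⇒m∸n≤o d k (≤-trans (covers-antipodal (w i) (w j) x c c′)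
             (+-monoˡ-≤ _ (code-dist≤ i j)))) ⟩
      base + penalty * ((1 ∸ jokers (w i)) + (1 ∸ jokers (w j)))
        ≤⟨ +-monoʳ-≤ base (*-monoʳ-≤ penalty
             (+-mono-≤ (covers⇒jokerless i x c) (covers⇒jokerless j (antipode x) c′))) ⟩
      base + penalty * (heavy x + heavy (antipode x)) ∎
      where open ≤-Reasoning

    -- A word with `j` jokers loads `2 ^ j` vertices with `weight j` each, which is at least `total`
    -- altogether.
    total-load : m * total ≤ ∑cube load
    total-load = begin
      m * total                                        ≡⟨ sum-const m total ⟨
      ∑[ i < m ] total                                 ≤⟨ sum-mono (λ i → total≤ (jokers (w i))) ⟩
      ∑[ i < m ] (2 ^ jokers (w i) * weight (jokers (w i)))
        ≡⟨ sum-cong-≗ (λ i → ∑cube-covers (w i) (weight (jokers (w i)))) ⟨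
      ∑[ i < m ] ∑cube (λ x → share x i)               ≡⟨ ∑cube-∑ (λ i x → share x i) ⟨
      ∑cube load                                       ∎
      where open ≤-Reasoning

    -- Double counting: `load-antipodal` is summed over all vertices, so every antipodal pair occurs
    -- twice; this is the source of the factors 2.
    size-bound : 2 * (m * total) ≤ 2 ^ d * base + penalty * (2 * card jokerless)
    size-bound = begin
      2 * (m * total)                                  ≤⟨ *-monoʳ-≤ 2 total-load ⟩
      2 * ∑cube load                                   ≡⟨ cong (∑cube load +_) (+-identityʳ _) ⟩
      ∑cube load + ∑cube load                          ≡⟨ cong (∑cube load +_) (∑cube-antipode load) ⟨
      ∑cube load + ∑cube (load ∘ antipode)             ≡⟨ ∑cube-+ load (load ∘ antipode) ⟨
      ∑cube (λ x → load x + load (antipode x))         ≤⟨ ∑cube-mono load-antipodal ⟩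
      ∑cube (λ x → base + penalty * (heavy x + heavy (antipode x)))
        ≡⟨ ∑cube-+ {d} (λ _ → base) (λ x → penalty * (heavy x + heavy (antipode x))) ⟩
      ∑cube {d} (λ _ → base) + ∑cube (λ x → penalty * (heavy x + heavy (antipode x)))
        ≡⟨ cong₂ _+_ (∑cube-const d base) (∑cube-* penalty (λ x → heavy x + heavy (antipode x))) ⟩
      2 ^ d * base + penalty * ∑cube (λ x → heavy x + heavy (antipode x))
        ≡⟨ cong (λ s → 2 ^ d * base + penalty * s) (trans (∑cube-+ heavy (heavy ∘ antipode))
             (cong (∑cube heavy +_) (trans (∑cube-antipode heavy) (sym (+-identityʳ _))))) ⟩
      2 ^ d * base + penalty * (2 * card jokerless)    ∎
      where open ≤-Reasoning

-- The weights are the least ones with `2 ^ j * weight j` at least 4. The base is attained by two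
-- words with one joker each; the penalty is the excess 4 + 1 - 4 of a vertex opposite a word with
-- two or more jokers.
weighting₂ : Weighting 2
weighting₂ = record
  { weight = weight ; total = 4 ; base = 4 ; penalty = 1
  ; total≤ = total≤ ; single≤ = single≤ ; pair≤ = pair≤ }
  where
  weight : ℕ → ℕ
  weight 0 = 4
  weight 1 = 2
  weight _ = 1
  total≤ : ∀ j → 4 ≤ 2 ^ j * weight j
  total≤ 0 = ≤-refl
  total≤ 1 = ≤-refl
  total≤ (suc (suc j)) = ≤-trans (^-monoʳ-≤ 2 {2} {2 + j} (s≤s (s≤s z≤n))) (≤-reflexive (sym (*-identityʳ _)))
  single≤ : ∀ j → weight j ≤ 4 + 1 * (1 ∸ j)
  single≤ 0 = m≤m+n 4 1
  single≤ 1 = s≤s (s≤s z≤n)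
  single≤ (suc (suc j)) = s≤s z≤n
  pair≤ : ∀ i j → 2 ≤ i + j → weight i + weight j ≤ 4 + 1 * ((1 ∸ i) + (1 ∸ j))
  pair≤ 0 1 (s≤s ())
  pair≤ 1 0 (s≤s ())
  pair≤ 0 (suc (suc j)) _ = ≤-refl
  pair≤ (suc (suc i)) 0 _ = ≤-refl
  pair≤ 1 1 _ = ≤-refl
  pair≤ 1 (suc (suc j)) _ = m≤m+n 3 _
  pair≤ (suc (suc i)) 1 _ = m≤m+n 3 _
  pair≤ (suc (suc i)) (suc (suc j)) _ = m≤m+n 2 _

-- The same choice with total 8: the base 4 + 2 comes from one joker opposite two, and the penalty
-- is the excess 8 + 1 - 6.
weighting₃ : Weighting 3
weighting₃ = record
  { weight = weight ; total = 8 ; base = 6 ; penalty = 3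
  ; total≤ = total≤ ; single≤ = single≤ ; pair≤ = pair≤ }
  where
  weight : ℕ → ℕ
  weight 0 = 8
  weight 1 = 4
  weight 2 = 2
  weight _ = 1
  total≤ : ∀ j → 8 ≤ 2 ^ j * weight j
  total≤ 0 = ≤-refl
  total≤ 1 = ≤-refl
  total≤ 2 = ≤-refl
  total≤ (suc (suc (suc j))) =
    ≤-trans (^-monoʳ-≤ 2 {3} {3 + j} (s≤s (s≤s (s≤s z≤n)))) (≤-reflexive (sym (*-identityʳ _)))
  single≤ : ∀ j → weight j ≤ 6 + 3 * (1 ∸ j)
  single≤ 0 = m≤m+n 8 1
  single≤ 1 = m≤m+n 4 2
  single≤ 2 = m≤m+n 2 4
  single≤ (suc (suc (suc j))) = s≤s z≤n
  pair≤ : ∀ i j → 3 ≤ i + j → weight i + weight j ≤ 6 + 3 * ((1 ∸ i) + (1 ∸ j))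
  pair≤ 0 1 (s≤s ())
  pair≤ 0 2 (s≤s (s≤s ()))
  pair≤ 1 0 (s≤s ())
  pair≤ 1 1 (s≤s (s≤s ()))
  pair≤ 2 0 (s≤s (s≤s ()))
  pair≤ 0 (suc (suc (suc j))) _ = ≤-refl
  pair≤ (suc (suc (suc i))) 0 _ = ≤-refl
  pair≤ 1 2 _ = ≤-refl
  pair≤ 2 1 _ = ≤-refl
  pair≤ 1 (suc (suc (suc j))) _ = m≤m+n 5 _
  pair≤ (suc (suc (suc i))) 1 _ = m≤m+n 5 _
  pair≤ 2 2 _ = m≤m+n 4 _
  pair≤ 2 (suc (suc (suc j))) _ = m≤m+n 3 _
  pair≤ (suc (suc (suc i))) 2 _ = m≤m+n 3 _
  pair≤ (suc (suc (suc i))) (suc (suc (suc j))) _ = m≤m+n 2 _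

-- The implicit argument says that `suc n` words would violate `size-bound`; it is a closed
-- inequality at each use and is settled by evaluation.
code-bound : (𝓦 : Weighting (d ∸ k)) → let open Weighting 𝓦 in
  ∀ M n → (∀ {Z : Vertex d → Bool} → Z ≤diam k → card Z ≤ M) →
  {True (2 ^ d * base + penalty * (2 * M) <? 2 * (suc n * total))} → Code k d m → m ≤ n
code-bound {d} 𝓦 M n Z≤M {small} (w , isCode) = ≤-pred (*-cancelʳ-< total _ _
  (*-cancelˡ-< 2 _ _ (≤-<-trans (≤-trans (size-bound {w = w} isCode 𝓦)
    (+-monoʳ-≤ (2 ^ d * base) (*-monoʳ-≤ penalty (*-monoʳ-≤ 2 (Z≤M (jokerless-diam {w = w} isCode))))))
    (toWitness small))))
  where open Weighting 𝓦

upper₃₅ : Code 3 5 m → m ≤ 18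
upper₃₅ = code-bound weighting₂ 10 18 (diam⇒card≤ (m≤m+n 5 3) bound₅ ≤-refl)

upper₄₆ : Code 4 6 m → m ≤ 37
upper₄₆ = code-bound weighting₂ 22 37 (diam⇒card≤ (m≤m+n 6 2) bound₆ ≤-refl)

upper₅₇ : Code 5 7 m → m ≤ 75
upper₅₇ = code-bound weighting₂ 44 75 (diam⇒card≤ (m≤m+n 7 1) bound₇ ≤-refl)

upper₆₈ : Code 6 8 m → m ≤ 151
upper₆₈ = code-bound weighting₂ 93 151 (diam⇒card≤ (m≤m+n 8 0) bound₈ ≤-refl)

upper₃₆ : Code 3 6 m → m ≤ 28
upper₃₆ = code-bound weighting₃ 12 28 (diam⇒card≤² (m≤m+n 6 2) bound²₆ ≤-refl)

-- Dedekind reals and intervals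

≤ʳ-refl : x ≤ʳ x
≤ʳ-refl _ x∋q = x∋q

≤ʳ-trans : x ≤ʳ y → y ≤ʳ z → x ≤ʳ z
≤ʳ-trans x≤y y≤z q x∋q = y≤z q (x≤y q x∋q)

<ʳ⇒≱ʳ : x <ʳ y → ¬ (y ≤ʳ x)
<ʳ⇒≱ʳ {x} (q , x<q , q<y) y≤x = disjoint x (y≤x q q<y , x<q)

lower-≤ : ∀ x → p ℚ.≤ q → lower x q → lower x p
lower-≤ {p} {q} x p≤q q<x with ℚ.<-cmp p q
... | tri< p<q _ _  = lower-closed x p<q q<x
... | tri≈ _ refl _ = q<x
... | tri> _ _ q<p  = contradiction (ℚ.≤-<-trans p≤q q<p) (ℚ.<-irrefl refl)

upper-≤ : ∀ x → p ℚ.≤ q → upper x p → upper x q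
upper-≤ {p} {q} x p≤q x<p with ℚ.<-cmp p q
... | tri< p<q _ _  = upper-closed x p<q x<p
... | tri≈ _ refl _ = x<p
... | tri> _ _ q<p  = contradiction (ℚ.≤-<-trans p≤q q<p) (ℚ.<-irrefl refl)

lower-⊔ : ∀ x → lower x p → lower x q → lower x (p ℚ.⊔ q)
lower-⊔ {p} {q} x p<x q<x with ℚ.⊔-sel p q
... | inj₁ eq = subst (lower x) (sym eq) p<x
... | inj₂ eq = subst (lower x) (sym eq) q<x

upper-⊓ : ∀ x → upper x p → upper x q → upper x (p ℚ.⊓ q)
upper-⊓ {p} {q} x x<p x<q with ℚ.⊓-sel p q
... | inj₁ eq = subst (upper x) (sym eq) x<p
... | inj₂ eq = subst (upper x) (sym eq) x<q

ι : ℚ → ℝ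
ι p = record
  { lower           = ℚ._< p
  ; upper           = p ℚ.<_
  ; lower-inhabited = p ℚ.- 1ℚ , subst (p ℚ.- 1ℚ ℚ.<_) (ℚ.+-identityʳ p) (ℚ.+-monoʳ-< p (from-yes (ℚ.- 1ℚ ℚ.<? 0ℚ)))
  ; upper-inhabited = p ℚ.+ 1ℚ , subst (ℚ._< p ℚ.+ 1ℚ) (ℚ.+-identityʳ p) (ℚ.+-monoʳ-< p (from-yes (0ℚ ℚ.<? 1ℚ)))
  ; lower-closed    = ℚ.<-trans
  ; upper-closed    = λ q<r p<q → ℚ.<-trans p<q q<r
  ; lower-rounded   = λ q<p → let r , q<r , r<p = ℚ.<-dense q<p in r , q<r , r<p
  ; upper-rounded   = λ p<r → let q , p<q , q<r = ℚ.<-dense p<r in q , q<r , p<q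
  ; disjoint        = λ (q<p , p<q) → ℚ.<-asym q<p p<q
  ; located         = ι-located
  }
  where
  ι-located : ∀ {q r} → q ℚ.< r → q ℚ.< p ⊎ p ℚ.< r
  ι-located {q} q<r with q ℚ.<? p
  ... | yes q<p = inj₁ q<p
  ... | no  q≮p = inj₂ (ℚ.≤-<-trans (ℚ.≮⇒≥ q≮p) q<r)

ι-mono-≤ : p ℚ.≤ q → ι p ≤ʳ ι q
ι-mono-≤ p≤q r r<p = ℚ.<-≤-trans r<p p≤q

ι-mono-< : p ℚ.< q → ι p <ʳ ι q
ι-mono-< = ℚ.<-dense

lower⇒ι≤ : ∀ x → lower x p → ι p ≤ʳ x
lower⇒ι≤ x p<x q q<p = lower-closed x q<p p<x

upper⇒≤ι : ∀ x → upper x p → x ≤ʳ ι p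
upper⇒≤ι {p} x x<p q q<x with q ℚ.<? p
... | yes q<p = q<p
... | no  q≮p = contradiction (lower-≤ x (ℚ.≮⇒≥ q≮p) q<x , x<p) (disjoint x)

-- Intersections of two closed intervals

_∈ᴵ_ : ℝ → ClosedInterval → Set
x ∈ᴵ I = lo I ≤ʳ x × x ≤ʳ hi I

lo∈ : ∀ I → lo I ∈ᴵ I
lo∈ I = ≤ʳ-refl {lo I} , lo≤hi I

hi∈ : ∀ I → hi I ∈ᴵ I
hi∈ I = lo≤hi I , ≤ʳ-refl {hi I}

-- For nondegenerate intervals with a common point this means that they share exactly one point.
Abut : ClosedInterval → ClosedInterval → Set
Abut I J = hi I ≈ʳ lo J ⊎ hi J ≈ʳ lo I

strictly-between : x <ʳ y → x <ʳ z → ∃[ q ] (upper x q × lower y q × lower z q)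
strictly-between {x} {y} {z} (p , x<p , p<y) (q , x<q , q<z) =
  p ℚ.⊓ q , upper-⊓ x x<p x<q , lower-≤ y (ℚ.p⊓q≤p p q) p<y , lower-≤ z (ℚ.p⊓q≤q p q) q<z

-- Otherwise lo I < hi J as well, so some rational lies strictly inside both I
-- and J, and so does a larger one, and they are two distinct common points.
hi≤lo : lo I <ʳ hi I → lo J <ʳ hi J →
        (∀ x y → x ∈ᴵ I → x ∈ᴵ J → y ∈ᴵ I → y ∈ᴵ J → x ≤ʳ y) →
        lo J <ʳ hi I → hi J ≤ʳ lo I
hi≤lo {I} {J} I° J° unique J<I q q<J with lower-rounded (hi J) q<J
-- Locatedness stands in for the undecidable comparison of `lo I` with `hi J`: its second case
-- yields `lo I < hi J`.
... | r , q<r , r<J with located (lo I) q<r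
...   | inj₁ q<I = q<I
...   | inj₂ I<r with strictly-between {lo I} {hi I} {hi J} I° (r , I<r , r<J)
                    | strictly-between {lo J} {hi I} {hi J} J<I J°
...     | a , I<a , a<I , a<J | b , J<b , b<I , b<J
  with lower-⊔ (hi I) a<I b<I | lower-⊔ (hi J) a<J b<J
...     | s<I | s<J with lower-rounded (hi I) s<I | lower-rounded (hi J) s<J
...     | t , s<t , t<I | u , s<u , u<J =
  contradiction (unique (ι v) (ι s) (v∈ I I<s (lower-≤ (hi I) (ℚ.p⊓q≤p t u) t<I))
                                    (v∈ J J<s (lower-≤ (hi J) (ℚ.p⊓q≤q t u) u<J))
                                    (s∈ I I<s s<I) (s∈ J J<s s<J))
    (<ʳ⇒≱ʳ {ι s} {ι v} (ι-mono-< s<v))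
  where
  s = a ℚ.⊔ b
  v = t ℚ.⊓ u
  s<v : s ℚ.< v
  s<v with ℚ.⊓-sel t u
  ... | inj₁ eq = subst (s ℚ.<_) (sym eq) s<t
  ... | inj₂ eq = subst (s ℚ.<_) (sym eq) s<u
  I<s : upper (lo I) s
  I<s = upper-≤ (lo I) (ℚ.p≤p⊔q a b) I<a
  J<s : upper (lo J) s
  J<s = upper-≤ (lo J) (ℚ.p≤q⊔p a b) J<b
  s∈ : ∀ K → upper (lo K) s → lower (hi K) s → ι s ∈ᴵ K
  s∈ K K<s s<K = upper⇒≤ι (lo K) K<s , lower⇒ι≤ (hi K) s<K
  v∈ : ∀ K → upper (lo K) s → lower (hi K) v → ι v ∈ᴵ K
  v∈ K K<s v<K = upper⇒≤ι (lo K) (upper-closed (lo K) s<v K<s) , lower⇒ι≤ (hi K) v<K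

module _ {I J B : ClosedInterval} (I° : lo I <ʳ hi I) (J° : lo J <ʳ hi J)
         (meet : ∀ x → (x ∈ᴵ I × x ∈ᴵ J) ⇔ x ∈ᴵ B) where

  private
    to : ∀ x → x ∈ᴵ I → x ∈ᴵ J → x ∈ᴵ B
    to x x∈I x∈J = Equivalence.to (meet x) (x∈I , x∈J)

    from : ∀ x → x ∈ᴵ B → x ∈ᴵ I × x ∈ᴵ J
    from x = Equivalence.from (meet x)

  meet⇒lo≤hi : lo I ≤ʳ hi J × lo J ≤ʳ hi I
  meet⇒lo≤hi with from (lo B) (lo∈ B)
  ... | (I≤b , b≤I) , (J≤b , b≤J) =
    ≤ʳ-trans {lo I} {lo B} {hi J} I≤b b≤J , ≤ʳ-trans {lo J} {lo B} {hi I} J≤b b≤I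

  -- If the intervals abut, both ends of `B` are squeezed to the shared end point.
  nondegenerate⇒¬Abut : lo B <ʳ hi B → ¬ Abut I J
  nondegenerate⇒¬Abut B° abut with from (lo B) (lo∈ B) | from (hi B) (hi∈ B)
  ... | (I≤b , b≤I) , (J≤b , b≤J) | (I≤c , c≤I) , (J≤c , c≤J) = <ʳ⇒≱ʳ {lo B} {hi B} B° (case abut)
    where
    case : Abut I J → hi B ≤ʳ lo B
    case (inj₁ (I≤J , _)) q q<c = J≤b q (I≤J q (c≤I q q<c))
    case (inj₂ (J≤I , _)) q q<c = I≤b q (J≤I q (c≤J q q<c))

  degenerate⇒unique : hi B ≤ʳ lo B → ∀ x y → x ∈ᴵ I → x ∈ᴵ J → y ∈ᴵ I → y ∈ᴵ J → x ≤ʳ y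
  degenerate⇒unique hiB≤loB x y x∈I x∈J y∈I y∈J p p<x =
    proj₁ (to y y∈I y∈J) p (hiB≤loB p (proj₂ (to x x∈I x∈J) p p<x))

  -- A rational `q` strictly inside `I` is located against `lo J`. If `q` is below `lo J`, then
  -- `lo I < hi J` and `hi≤lo` puts `I` before `J`; otherwise `lo J < hi I` and `J` comes before
  -- `I`.
  degenerate⇒Abut : hi B ≤ʳ lo B → Abut I J
  degenerate⇒Abut hiB≤loB with lower-rounded (hi I) (proj₂ (proj₂ I°))
  ... | r , q<r , r<I with located (lo J) q<r
  ...   | inj₁ q<J = inj₁ (hi≤lo {J} {I} J° I° (λ x y x∈J x∈I y∈J y∈I → degenerate⇒unique hiB≤loB x y x∈I x∈J y∈I y∈J)
                        (_ , proj₁ (proj₂ I°) , lo≤hi J _ q<J) , proj₂ meet⇒lo≤hi)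
  ...   | inj₂ J<r = inj₂ (hi≤lo {I} {J} I° J° (degenerate⇒unique hiB≤loB) (r , J<r , r<I) , proj₁ meet⇒lo≤hi)

-- In one coordinate all abutting pairs of intervals meet in the same point.
-- Intervals ending there get the letter 0, intervals starting there the letter 1.
module _ (I : Fin m → ClosedInterval) (I° : ∀ i → lo (I i) <ʳ hi (I i))
         (I≤I : ∀ i j → lo (I i) ≤ʳ hi (I j)) (abut? : ∀ i j → Dec (Abut (I i) (I j))) where

  private
    Touch : Fin m → Fin m → Set
    Touch i j = hi (I i) ≤ʳ lo (I j)

    touch? : ∀ i j → Dec (Touch i j)
    touch? i j with abut? i j
    ... | yes (inj₁ (Ii≤Ij , _)) = yes Ii≤Ij
    ... | yes (inj₂ (Ij≤Ii , _)) = no λ Ii≤Ij → <ʳ⇒≱ʳ {lo (I i)} {hi (I i)} (I° i)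
      (λ q q<Ii → Ij≤Ii q (lo≤hi (I j) q (Ii≤Ij q q<Ii)))
    ... | no ¬abut = no λ Ii≤Ij → ¬abut (inj₁ (Ii≤Ij , I≤I j i))

    -- Any two of the intervals meet, so `lo (I j)` is at most `hi (I k)`. Hence all touching pairs
    -- touch at the same point.
    touch-trans : ∀ {i j k l} → Touch i j → Touch k l → Touch i l
    touch-trans {i} {j} {k} {l} ij kl q q<Ii = kl q (I≤I j k q (ij q q<Ii))

    touch⇒abut : ∀ {i j} → Touch i j → Abut (I i) (I j)
    touch⇒abut {i} {j} ij = inj₁ (ij , I≤I j i)

    abut-sym : ∀ {i j} → Abut (I i) (I j) → Abut (I j) (I i)
    abut-sym (inj₁ p) = inj₂ p
    abut-sym (inj₂ p) = inj₁ p

  letters : ∃[ L ] (∀ i j → clash (L i) (L j) ≡ true ⇔ Abut (I i) (I j))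
  letters with any? (λ i → any? (λ j → touch? i j))
  ... | no none = const nothing , λ i j → mk⇔ (λ ())
    (λ { (inj₁ (ij , _)) → contradiction (i , j , ij) none
       ; (inj₂ (ji , _)) → contradiction (j , i , ji) none })
  ... | yes (a , b , ab) = L , λ i j → mk⇔ (clash⇒abut i j)
    (λ { (inj₁ (ij , _)) → touch⇒clash ij
       ; (inj₂ (ji , _)) → trans (clash-comm (L i) (L j)) (touch⇒clash ji) })
    where
    -- The common point is both `hi (I a)` and `lo (I b)`: an interval ends there when it touches
    -- `I b`, and starts there when `I a` touches it.
    L : Fin m → Letter
    L i with touch? i b | touch? a i
    ... | yes _ | _     = just false
    ... | no _  | yes _ = just true
    ... | no _  | no _  = nothing

    clash⇒abut : ∀ i j → clash (L i) (L j) ≡ true → Abut (I i) (I j)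
    clash⇒abut i j eq with touch? i b | touch? a i | touch? j b | touch? a j
    clash⇒abut i j () | yes _  | _      | yes _  | _
    clash⇒abut i j _  | yes ib | _      | no _   | yes aj = touch⇒abut (touch-trans ib aj)
    clash⇒abut i j () | yes _  | _      | no _   | no _
    clash⇒abut i j _  | no _   | yes ai | yes jb | _      = abut-sym (touch⇒abut (touch-trans jb ai))
    clash⇒abut i j () | no _   | yes _  | no _   | yes _
    clash⇒abut i j () | no _   | yes _  | no _   | no _
    clash⇒abut i j () | no _   | no _   | _      | _

    touch⇒clash : ∀ {i j} → Touch i j → clash (L i) (L j) ≡ true
    touch⇒clash {i} {j} ij with touch? i b | touch? a i | touch? j b | touch? a j
    ... | no ¬ib | _ | _      | _      = contradiction (touch-trans ij ab) ¬ib
    ... | yes _  | _ | yes jb | _      = contradiction (touch-trans jb ij) (<ʳ⇒≱ʳ {lo (I j)} {hi (I j)} (I° j))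
    ... | yes _  | _ | no _   | no ¬aj = contradiction (touch-trans ab ij) ¬aj
    ... | yes _  | _ | no _   | yes _  = refl

-- From neighborly families to codes

∈-clashes : ∀ (u v : Word d) c → c ∈ clashes u v ⇔ clash (lookup u c) (lookup v c) ≡ true
∈-clashes u v c = mk⇔
  (λ c∈ → trans (sym (Vec.lookup-zipWith clash c u v)) (Vec.[]=⇒lookup c∈))
  (λ eq → Vec.lookup⇒[]= c (clashes u v) (trans (Vec.lookup-zipWith clash c u v) eq))

-- All coordinates but one are frozen at the left ends of B.
meet-coordinate : ∀ {K L B : Box d} →
  (∀ x → ((∀ c → x c ∈ᴵ K c) × (∀ c → x c ∈ᴵ L c)) ⇔ (∀ c → x c ∈ᴵ B c)) →
  ∀ c x → (x ∈ᴵ K c × x ∈ᴵ L c) ⇔ x ∈ᴵ B c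
meet-coordinate {d} {K} {L} {B} meet c x = mk⇔ to′ from′
  where
  corner : Fin d → ℝ
  corner e = lo (B e)
  point : Fin d → ℝ
  point = updateAt corner c (const x)
  at : ∀ (M : Box d) → (∀ e → corner e ∈ᴵ M e) → x ∈ᴵ M c → ∀ e → point e ∈ᴵ M e
  at M corner∈ x∈ e with e Fin.≟ c
  ... | yes refl = subst (_∈ᴵ M c) (sym (updateAt-updates c corner)) x∈
  ... | no e≢c   = subst (_∈ᴵ M e) (sym (updateAt-minimal e c corner e≢c)) (corner∈ e)
  at-c : ∀ M → point c ∈ᴵ M → x ∈ᴵ M
  at-c M = subst (_∈ᴵ M) (updateAt-updates c corner)
  corner∈B : ∀ e → corner e ∈ᴵ B e
  corner∈B e = lo∈ (B e)
  to′ : x ∈ᴵ K c × x ∈ᴵ L c → x ∈ᴵ B c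
  to′ (x∈K , x∈L) with Equivalence.from (meet corner) corner∈B
  ... | corner∈K , corner∈L =
    at-c (B c) (Equivalence.to (meet point) (at K corner∈K x∈K , at L corner∈L x∈L) c)
  from′ : x ∈ᴵ B c → x ∈ᴵ K c × x ∈ᴵ L c
  from′ x∈B with Equivalence.from (meet point) (at B corner∈B x∈B)
  ... | point∈K , point∈L = at-c (K c) (point∈K c) , at-c (L c) (point∈L c)

-- The words clash exactly in the degenerate coordinates of the intersection, so their distance is
-- its codimension. With a successor as dimension, the upper bound on the dimension of the
-- intersection reduces to `d`.
family⇒code : NeighborlyFamily k (suc d) m → Code k (suc d) m
family⇒code {k} {d} {m} (F , neighborly) = w , isCode
  where
  open Neighborly neighborly

  F° : ∀ i c → lo (F i c) <ʳ hi (F i c)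
  F° i c with full-dimensional i
  ... | T , ∣T∣≡d , inside , _ = inside c (subst (c ∈_) (sym (Subset.∣p∣≡n⇒p≡⊤ ∣T∣≡d)) Subset.∈⊤)

  coordinate : ∀ i j → i ≢ j → ∃[ T ] (suc d ∸ k ≤ ∣ T ∣ × ∣ T ∣ ≤ d
    × (∀ c → (lo (F i c) ≤ʳ hi (F j c)) × (c ∈ T → ¬ Abut (F i c) (F j c)) × (c ∉ T → Abut (F i c) (F j c))))
  coordinate i j i≢j with intersections i j i≢j
  ... | e , (B , (⊆B , B⊆) , T , refl , inside , outside) , lower-bound , upper-bound =
    T , lower-bound , upper-bound , λ c →
      proj₁ (meet⇒lo≤hi {F i c} {F j c} {B c} (F° i c) (F° j c) (meet c)) ,
      (λ c∈T → nondegenerate⇒¬Abut {F i c} {F j c} {B c} (F° i c) (F° j c) (meet c) (inside c c∈T)) ,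
      degenerate c
    where
    meet = meet-coordinate {K = F i} {F j} {B} (λ x → mk⇔ (⊆B {x}) (B⊆ {x}))
    degenerate : ∀ c → c ∉ T → Abut (F i c) (F j c)
    degenerate c c∉T = degenerate⇒Abut {F i c} {F j c} {B c} (F° i c) (F° j c) (meet c) (proj₂ (outside c c∉T))

  lo≤hi′ : ∀ c i j → lo (F i c) ≤ʳ hi (F j c)
  lo≤hi′ c i j with i Fin.≟ j
  ... | yes refl = lo≤hi (F i c)
  ... | no i≢j   = proj₁ (proj₂ (proj₂ (proj₂ (coordinate i j i≢j))) c)

  -- The order of reals is undecidable, but the set `T` that witnesses the dimension of the
  -- intersection tells which coordinates are degenerate.
  abut? : ∀ c i j → Dec (Abut (F i c) (F j c))
  abut? c i j with i Fin.≟ j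
  ... | yes refl = no [ (λ (hi≤lo , _) → <ʳ⇒≱ʳ {lo (F i c)} {hi (F i c)} (F° i c) hi≤lo)
                      , (λ (hi≤lo , _) → <ʳ⇒≱ʳ {lo (F i c)} {hi (F i c)} (F° i c) hi≤lo) ]′
  ... | no i≢j with coordinate i j i≢j
  ...   | T , _ , _ , spec with c Subset.∈? T
  ...     | yes c∈T = no (proj₁ (proj₂ (spec c)) c∈T)
  ...     | no  c∉T = yes (proj₂ (proj₂ (spec c)) c∉T)

  column : ∀ c → ∃[ L ] (∀ i j → clash (L i) (L j) ≡ true ⇔ Abut (F i c) (F j c))
  column c = letters (λ i → F i c) (λ i → F° i c) (lo≤hi′ c) (abut? c)

  w : Fin m → Word (suc d)
  w i = tabulate (λ c → proj₁ (column c) i)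

  clash⇔Abut : ∀ i j c → clash (lookup (w i) c) (lookup (w j) c) ≡ true ⇔ Abut (F i c) (F j c)
  clash⇔Abut i j c rewrite Vec.lookup∘tabulate (λ c → proj₁ (column c) i) c
                         | Vec.lookup∘tabulate (λ c → proj₁ (column c) j) c = proj₂ (column c) i j

  isCode : IsCode k w
  isCode i j i≢j with coordinate i j i≢j
  ... | T , lower-bound , upper-bound , spec =
    subst (λ e → 1 ≤ e × e ≤ k) (sym dist≡) (m<n⇒0<n∸m (s≤s upper-bound) , m≤n+o⇒m∸n≤o (suc d) ∣ T ∣ d≤)
    where
    d≤ : suc d ≤ ∣ T ∣ + k
    d≤ = ≤-trans (m≤n+m∸n (suc d) k) (≤-trans (+-monoʳ-≤ k lower-bound) (≤-reflexive (+-comm k ∣ T ∣)))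
    clashes≡ : clashes (w i) (w j) ≡ ∁ T
    clashes≡ = Subset.⊆-antisym
      (λ {c} c∈ → Subset.x∉p⇒x∈∁p λ c∈T → proj₁ (proj₂ (spec c)) c∈T
        (Equivalence.to (clash⇔Abut i j c) (Equivalence.to (∈-clashes (w i) (w j) c) c∈)))
      (λ {c} c∈ → Equivalence.from (∈-clashes (w i) (w j) c)
        (Equivalence.from (clash⇔Abut i j c) (proj₂ (proj₂ (spec c)) (Subset.x∈∁p⇒x∉p c∈))))
    dist≡ : dist (w i) (w j) ≡ suc d ∸ ∣ T ∣
    dist≡ = trans (cong ∣_∣ clashes≡) (Subset.∣∁p∣≡n∸∣p∣ T)

-- Boxes from words

-- The letters 0, 1 and the joker become [0, 1], [1, 2] and [0, 2]; two of these meet in a single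
-- point exactly when the letters clash.
start end : Letter → ℚ
start (just true) = 1ℚ
start _           = 0ℚ
end (just false)  = 1ℚ
end _             = 1ℚ ℚ.+ 1ℚ

decide-< : ∀ {p q} → {True (p ℚ.<? q)} → p ℚ.< q
decide-< {_} {_} {t} = toWitness t

start<end : ∀ u v → clash u v ≡ false → start u ℚ.⊔ start v ℚ.< end u ℚ.⊓ end v
start<end nothing      nothing      _ = decide-<
start<end nothing      (just false) _ = decide-<
start<end nothing      (just true)  _ = decide-<
start<end (just false) nothing      _ = decide-<
start<end (just true)  nothing      _ = decide-<
start<end (just false) (just false) _ = decide-<
start<end (just true)  (just true)  _ = decide-<

start≡end : ∀ u v → clash u v ≡ true → start u ℚ.⊔ start v ≡ end u ℚ.⊓ end v
start≡end (just false) (just true)  _ = refl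
start≡end (just true)  (just false) _ = refl

start≤end : ∀ u v → start u ℚ.⊔ start v ℚ.≤ end u ℚ.⊓ end v
start≤end u v with clash u v in eq
... | false = ℚ.<⇒≤ (start<end u v eq)
... | true  = ℚ.≤-reflexive (start≡end u v eq)

meet : Letter → Letter → ClosedInterval
meet u v = record
  { lo = ι (start u ℚ.⊔ start v) ; hi = ι (end u ℚ.⊓ end v) ; lo≤hi = ι-mono-≤ (start≤end u v) }

-- As a self-intersection, so that `meetBox-dim` also yields the dimension of a single box.
interval : Letter → ClosedInterval
interval u = meet u u

meet-∩ : ∀ u v {x} → (x ∈ᴵ interval u × x ∈ᴵ interval v) ⇔ x ∈ᴵ meet u v
meet-∩ u v {x} rewrite ℚ.⊔-idem (start u) | ℚ.⊔-idem (start v) | ℚ.⊓-idem (end u) | ℚ.⊓-idem (end v) =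
  mk⇔ to from
  where
  to : (ι (start u) ≤ʳ x × x ≤ʳ ι (end u)) × (ι (start v) ≤ʳ x × x ≤ʳ ι (end v)) → x ∈ᴵ meet u v
  to ((u≤x , x≤u) , (v≤x , x≤v)) =
    [ (λ eq → subst (λ p → ι p ≤ʳ x) (sym eq) u≤x) , (λ eq → subst (λ p → ι p ≤ʳ x) (sym eq) v≤x) ]′
      (ℚ.⊔-sel (start u) (start v)) ,
    [ (λ eq → subst (λ p → x ≤ʳ ι p) (sym eq) x≤u) , (λ eq → subst (λ p → x ≤ʳ ι p) (sym eq) x≤v) ]′
      (ℚ.⊓-sel (end u) (end v))
  from : x ∈ᴵ meet u v → (ι (start u) ≤ʳ x × x ≤ʳ ι (end u)) × (ι (start v) ≤ʳ x × x ≤ʳ ι (end v))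
  from (l≤x , x≤h) =
    ( (λ q q<u → l≤x q (ℚ.<-≤-trans q<u (ℚ.p≤p⊔q (start u) (start v))))
    , (λ q q<x → ℚ.<-≤-trans (x≤h q q<x) (ℚ.p⊓q≤p (end u) (end v)))) ,
    ( (λ q q<v → l≤x q (ℚ.<-≤-trans q<v (ℚ.p≤q⊔p (start u) (start v))))
    , (λ q q<x → ℚ.<-≤-trans (x≤h q q<x) (ℚ.p⊓q≤q (end u) (end v))))

meetBox : Word d → Word d → Box d
meetBox u v c = meet (lookup u c) (lookup v c)

box : Word d → Box d
box w = meetBox w w

meetBox-∩ : (u v : Word d) → (⟦ box u ⟧ ∩ ⟦ box v ⟧) ≐ ⟦ meetBox u v ⟧
meetBox-∩ u v =
  (λ {x} (x∈u , x∈v) c → Equivalence.to (coordinate x c) (x∈u c , x∈v c)) ,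
  (λ {x} x∈ → (λ c → proj₁ (Equivalence.from (coordinate x c) (x∈ c))) ,
              (λ c → proj₂ (Equivalence.from (coordinate x c) (x∈ c))))
  where
  coordinate : ∀ x c → (x c ∈ᴵ box u c × x c ∈ᴵ box v c) ⇔ x c ∈ᴵ meetBox u v c
  coordinate x c = meet-∩ (lookup u c) (lookup v c) {x c}

meetBox-dim : (u v : Word d) → BoxDim (meetBox u v) (d ∸ dist u v)
meetBox-dim u v = ∁ (clashes u v) , Subset.∣∁p∣≡n∸∣p∣ (clashes u v) , inside , outside
  where
  inside : ∀ c → c ∈ ∁ (clashes u v) → lo (meetBox u v c) <ʳ hi (meetBox u v c)
  inside c c∈ = ι-mono-< (start<end (lookup u c) (lookup v c)
    (Bool.¬-not (λ eq → Subset.x∈∁p⇒x∉p c∈ (Equivalence.from (∈-clashes u v c) eq))))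
  outside : ∀ c → c ∉ ∁ (clashes u v) → lo (meetBox u v c) ≈ʳ hi (meetBox u v c)
  outside c c∉ = ι-mono-≤ (ℚ.≤-reflexive eq) , ι-mono-≤ (ℚ.≤-reflexive (sym eq))
    where eq = start≡end (lookup u c) (lookup v c) (Equivalence.to (∈-clashes u v c) (Subset.x∉∁p⇒x∈p c∉))

code⇒family : Code k d m → NeighborlyFamily k d m
code⇒family {k} {d} (w , isCode) = box ∘ w , record
  { full-dimensional = λ i → subst (BoxDim (box (w i))) (cong (d ∸_) (dist-self (w i))) (meetBox-dim (w i) (w i))
  ; intersections    = λ i j i≢j →
      d ∸ dist (w i) (w j) ,
      (meetBox (w i) (w j) , meetBox-∩ (w i) (w j) , meetBox-dim (w i) (w j)) ,
      ∸-monoʳ-≤ d (proj₂ (isCode i j i≢j)) ,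
      ∸-monoʳ-≤ d (proj₁ (isCode i j i≢j))
  }

-- Existence of codes is decidable

Searchable : Set → Set₁
Searchable A = ∀ {P : A → Set} → (∀ a → Dec (P a)) → Dec (∃ P)

letter-searchable : Searchable Letter
letter-searchable P? with P? nothing | P? (just false) | P? (just true)
... | yes p | _     | _     = yes (_ , p)
... | no _  | yes p | _     = yes (_ , p)
... | no _  | no _  | yes p = yes (_ , p)
... | no ¬p | no ¬q | no ¬r = no λ
  { (nothing , p) → ¬p p ; (just false , q) → ¬q q ; (just true , r) → ¬r r }

vec-searchable : ∀ {A} → Searchable A → ∀ n → Searchable (Vec A n)
vec-searchable A? zero    P? = map′ ([] ,_) (λ { ([] , p) → p }) (P? [])
vec-searchable A? (suc n) P? = map′ (λ (x , xs , p) → x ∷ xs , p) (λ { (x ∷ xs , p) → x , xs , p })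
  (A? (λ x → vec-searchable A? n (λ xs → P? (x ∷ xs))))

isCode? : ∀ k (w : Fin m → Word d) → Dec (IsCode k w)
isCode? k w = all? λ i → all? λ j → ¬? (i Fin.≟ j) →-dec ((1 ≤? dist (w i) (w j)) ×-dec (dist (w i) (w j) ≤? k))

code? : ∀ k d m → Dec (Code k d m)
code? k d m = map′ (λ (ws , p) → lookup ws , p)
  (λ (w , p) → tabulate w , λ i j i≢j → subst₂ (λ u v → 1 ≤ dist u v × dist u v ≤ k)
    (sym (Vec.lookup∘tabulate w i)) (sym (Vec.lookup∘tabulate w j)) (p i j i≢j))
  (vec-searchable (vec-searchable letter-searchable d) m (λ ws → isCode? k (lookup ws)))

-- Descent from `l + n` to the first number satisfying `P`; it stops at `l` at the latest.
-- Decidability picks the maximum even where the bounds leave two candidates.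
maximum-exists : (P : ℕ → Set) → (∀ m → Dec (P m)) → ∀ l n → P l → (∀ m → P m → m ≤ l + n) →
                 ∃[ m ] (P m × (∀ m′ → P m′ → m′ ≤ m) × l ≤ m × m ≤ l + n)
maximum-exists P P? l zero    Pl P≤ =
  l , Pl , (λ m Pm → ≤-trans (P≤ m Pm) (≤-reflexive (+-identityʳ l))) , ≤-refl , m≤m+n l 0
maximum-exists P P? l (suc n) Pl P≤ with P? (l + suc n)
... | yes Ps = l + suc n , Ps , P≤ , m≤m+n l (suc n) , ≤-refl
... | no ¬Ps =
  let m , Pm , max , l≤m , m≤ = maximum-exists P P? l n Pl P≤′
  in m , Pm , max , l≤m , ≤-trans m≤ (+-monoʳ-≤ l (n≤1+n n))
  where
  P≤′ : ∀ m → P m → m ≤ l + n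
  P≤′ m Pm = ≤-pred (≤-trans (≤∧≢⇒< (P≤ m Pm) λ { refl → ¬Ps Pm }) (≤-reflexive (+-suc l n)))

value : Code k (suc d) m → (∀ m′ → Code k (suc d) m′ → m′ ≤ m) → n⟨ k , suc d ⟩≔ m
value code max = code⇒family code , λ m′ → max m′ ∘ family⇒code

value-between : ∀ k d l n → Code k (suc d) l → (∀ m → Code k (suc d) m → m ≤ l + n) →
                ∃[ m ] ((n⟨ k , suc d ⟩≔ m) × l ≤ m × m ≤ l + n)
value-between k d l n code max with maximum-exists (Code k (suc d)) (code? k (suc d)) l n code max
... | m , c , m-max , l≤m , m≤ = m , value c m-max , l≤m , m≤

-- Explicit codes

-- `AllPairs` relates earlier entries to later ones; symmetry supplies the other order.
lookup-allPairs : {R : A → A → Set ℓ} → Symmetric R → ∀ {xs} → AllPairs R xs →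
                  ∀ i j → i ≢ j → R (List.lookup xs i) (List.lookup xs j)
lookup-allPairs R-sym (_ ∷ _)   zero    zero    i≢j = contradiction refl i≢j
lookup-allPairs R-sym (px ∷ _)  zero    (suc j) _   = All.lookup px (∈-lookup j)
lookup-allPairs R-sym (px ∷ _)  (suc i) zero    _   = R-sym (All.lookup px (∈-lookup i))
lookup-allPairs R-sym (_ ∷ pxs) (suc i) (suc j) i≢j = lookup-allPairs R-sym pxs i j (i≢j ∘ cong suc)

dist-comm : (u v : Word d) → dist u v ≡ dist v u
dist-comm u v = cong ∣_∣ (Vec.zipWith-comm clash-comm u v)

listed : ∀ k (ws : List (Word d)) →
         {True (allPairs? (λ u v → (1 ≤? dist u v) ×-dec (dist u v ≤? k)) ws)} → Code k d (length ws)
listed k ws {t} = List.lookup ws , lookup-allPairs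
  (λ {u} {v} → subst (λ e → 1 ≤ e × e ≤ k) (dist-comm u v)) (toWitness t)

vertices : ∀ n → List (Vertex n)
vertices zero    = [] ∷ []
vertices (suc n) = List.map (false ∷_) (vertices n) ++ List.map (true ∷_) (vertices n)

0* 1* *0 *1 ** : Word 2
0* = just false ∷ nothing ∷ []
1* = just true ∷ nothing ∷ []
*0 = nothing ∷ just false ∷ []
*1 = nothing ∷ just true ∷ []
** = nothing ∷ nothing ∷ []

-- On the middle layer ∣ x ∣ = r + 1 of the (2r + 2)-cube, one of the two
-- partitions of the square into edges is used for x and the other one for its
-- antipode, so that words over antipodal vertices do not clash in the square.
fibre : ℕ → Vertex (suc n) → List (Word 2)
fibre r x =
  if ∣ x ∣ ≤ᵇ r then List.map ⌈_⌉ (vertices 2)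
  else if r + 1 <ᵇ ∣ x ∣ then ** ∷ []
  else if head x then *0 ∷ *1 ∷ [] else 0* ∷ 1* ∷ []

-- At most `2r + 2` clashes occur. Vertices at distance up to `2r` leave room for 2 clashes in the
-- square. At distance `2r + 1` one of them has weight above `r`, so its words have a joker in the
-- square. Antipodal vertices are both on the middle layer, or one of them carries only `**`.
layered : ∀ r → List (Word (2 + (2 + r * 2)))
layered r = concatMap (λ x → List.map (Vec._++ ⌈ x ⌉) (fibre r x)) (vertices (2 + r * 2))

-- Clashes add under concatenation: codes for `k` and `l` give one for `k + l`, and their sizes
-- multiply.
_⊗_ : ∀ {m n} → List (Word m) → List (Word n) → List (Word (m + n))
_⊗_ = cartesianProductWith Vec._++_

-- In either list any two words clash in exactly one place.
bits triangle : List (Word _)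
bits     = List.map ⌈_⌉ (vertices 1)
triangle = 0* ∷ ⌈ true ∷ false ∷ [] ⌉ ∷ ⌈ true ∷ true ∷ [] ⌉ ∷ []

code₃₅ : Code 3 5 18
code₃₅ = listed 3 (layered 0 ⊗ bits)

code₄₆ : Code 4 6 37
code₄₆ = listed 4 (layered 1)

code₃₆ : Code 3 6 27
code₃₆ = listed 3 (layered 0 ⊗ triangle)

code₅₇ : Code 5 7 74
code₅₇ = listed 5 (layered 1 ⊗ bits)

code₆₈ : Code 6 8 150
code₆₈ = listed 6 (layered 2)

corollary1p7 : (n⟨ 3 , 5 ⟩≔ 18)
    × (n⟨ 4 , 6 ⟩≔ 37)
    × (∃[ m ] ((n⟨ 3 , 6 ⟩≔ m) × 27 ≤ m × m ≤ 28))
    × (∃[ m ] ((n⟨ 5 , 7 ⟩≔ m) × 74 ≤ m × m ≤ 75))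
    × (∃[ m ] ((n⟨ 6 , 8 ⟩≔ m) × 150 ≤ m × m ≤ 151))
corollary1p7 =
    value code₃₅ (λ _ → upper₃₅)
  , value code₄₆ (λ _ → upper₄₆)
  , value-between 3 5 27 1 code₃₆ (λ _ → upper₃₆)
  , value-between 5 6 74 1 code₅₇ (λ _ → upper₅₇)
  , value-between 6 7 150 1 code₆₈ (λ _ → upper₆₈)
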